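{- Let $K\colon\mathbb{E}(D)\to\mathbb{E}(D)$ be an affine function and $u\colon D\to[0,\infty)$. If $\mathsf{D}K$ has a $u$-ranking supermartingale, then $\inf_n(\mathsf{D}K)^n(u)=\mathbb{O}$.
   Context: $\mathbb{E}(D)$ is the set of functions $D\to[0,\infty]$ with pointwise order and operations ($\infty+x=\infty$, $0\cdot\infty=0$, $r\cdot\infty=\infty$ for $r>0$); $\mathbb{O}$ is the constant zero function; for $x\ge y$ in $[0,\infty]$, $x-y$ is the least $z$ with $x=y+z$. $K$ is affine if $K(\alpha\eta_1+(1-\alpha)\eta_2)=\alpha K(\eta_1)+(1-\alpha)K(\eta_2)$ for all $\eta_1,\eta_2$ and $\alpha\in[0,1]$. $(\mathsf{D}K)(\eta)=K(\eta)-K(\mathbb{O})$. A $u$-ranking supermartingale with respect to $\mathsf{D}K$ is a function $r\colon D\to[0,\infty)$ with $(\mathsf{D}K)(r)+u\le r$. -}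

module Defs where

open import Level using (Level; 0ℓ; _⊔_) renaming (suc to lsuc)
open import Axiom.ExcludedMiddle using (ExcludedMiddle)
open import Data.Integer as ℤ using (+_; -[1+_])
import Data.Integer.Properties as ℤ
open import Data.Nat as ℕ using (ℕ; zero; suc)
import Data.Nat.Properties as ℕ
open import Data.Product using (Σ; ∃-syntax; _×_; _,_; proj₁; proj₂)
open import Data.Rational as ℚ using (ℚ; 0ℚ; 1ℚ; mkℚ)
import Data.Rational.Properties as ℚ
import Data.Rational.Unnormalised as ℚᵘ
import Data.Rational.Unnormalised.Properties as ℚᵘ
open import Data.Rational.Solver using (module +-*-Solver)
open import Data.Sum using (_⊎_; inj₁; inj₂)
open import Relation.Binary.Bundles using (Setoid)
open import Relation.Binary.Core using (Rel)
open import Relation.Binary.Definitions using (tri<; tri≈; tri>)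
open import Relation.Binary.PropositionalEquality using (_≡_; refl; cong; sym; subst; subst₂)
open import Relation.Nullary using (¬_; yes; no; contradiction)
open import Relation.Nullary.Decidable using (decidable-stable)

private
  variable
    a ℓ i : Level

IsLeast : {A : Set a} → Rel A ℓ → (A → Set i) → A → Set (a ⊔ ℓ ⊔ i)
IsLeast _≤_ P m = P m × (∀ z → P z → m ≤ z)

IsInfimum : {A : Set a} {I : Set i} → Rel A ℓ → (I → A) → A → Set (a ⊔ ℓ ⊔ i)
IsInfimum _≤_ f m = (∀ n → m ≤ f n) × (∀ l → (∀ n → l ≤ f n) → l ≤ m)

-- The extended half-line [0,∞]: an element x is the set of rationals strictly
-- below x. Every negative rational belongs to it; the cut containing all
-- rationals is ∞.
record ℝ≥0∞ : Set₁ where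
  field
    cut      : ℚ → Set
    negative : ∀ {q} → q ℚ.< 0ℚ → cut q
    lower    : ∀ {p q} → p ℚ.< q → cut q → cut p
    open′    : ∀ {p} → cut p → ∃[ q ] p ℚ.< q × cut q

infix 4 _≺_ _≤_ _≈_

_≺_ : ℚ → ℝ≥0∞ → Set
q ≺ x = ℝ≥0∞.cut x q

open ℝ≥0∞ public using (negative; lower; open′)

_≤_ : Rel ℝ≥0∞ 0ℓ
x ≤ y = ∀ q → q ≺ x → q ≺ y

_≈_ : Rel ℝ≥0∞ 0ℓ
x ≈ y = x ≤ y × y ≤ x

0∞ : ℝ≥0∞
0∞ = record
  { cut      = ℚ._< 0ℚ
  ; negative = λ q<0 → q<0
  ; lower    = ℚ.<-trans
  ; open′    = ℚ.<-dense
  }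

1∞ : ℝ≥0∞
1∞ = record
  { cut      = ℚ._< 1ℚ
  ; negative = λ q<0 → ℚ.<-trans q<0 (ℚ.positive⁻¹ 1ℚ)
  ; lower    = ℚ.<-trans
  ; open′    = ℚ.<-dense
  }

infixl 6 _+_ _-_
infixl 7 _*_

private
  module Rearrange where
    open +-*-Solver

    [p-s]+s : ∀ p s → (p ℚ.- s) ℚ.+ s ≡ p
    [p-s]+s = solve 2 (λ p s → (p :- s) :+ s := p) refl

    s+[p-s] : ∀ s p → s ℚ.+ (p ℚ.- s) ≡ p
    s+[p-s] = solve 2 (λ s p → s :+ (p :- s) := p) refl

    [q+p]-p : ∀ q p → (q ℚ.+ p) ℚ.- p ≡ q
    [q+p]-p = solve 2 (λ q p → (q :+ p) :- p := q) refl

    [s-a]+[a+[r-s]] : ∀ s a r → (s ℚ.- a) ℚ.+ (a ℚ.+ (r ℚ.- s)) ≡ r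
    [s-a]+[a+[r-s]] = solve 3 (λ s a r → (s :- a) :+ (a :+ (r :- s)) := r) refl

  open Rearrange

  <⇒-<0 : ∀ {p q} → p ℚ.< q → p ℚ.- q ℚ.< 0ℚ
  <⇒-<0 {p} {q} p<q =
    subst (p ℚ.- q ℚ.<_) (ℚ.+-inverseʳ q) (ℚ.+-monoˡ-< (ℚ.- q) p<q)

  <⇒0<- : ∀ {p q} → p ℚ.< q → 0ℚ ℚ.< q ℚ.- p
  <⇒0<- {p} {q} p<q =
    subst (ℚ._< q ℚ.- p) (ℚ.+-inverseʳ p) (ℚ.+-monoˡ-< (ℚ.- p) p<q)

_+_ : ℝ≥0∞ → ℝ≥0∞ → ℝ≥0∞
x + y = record
  { cut      = λ q → ∃[ a ] ∃[ b ] a ≺ x × b ≺ y × q ℚ.< a ℚ.+ b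
  ; negative = λ {q} q<0 →
      let s , q<s , s<0 = ℚ.<-dense q<0
          t , s<t , t<0 = ℚ.<-dense s<0
      in q ℚ.- s , t , negative x (<⇒-<0 q<s) , negative y t<0 ,
         subst (ℚ._< (q ℚ.- s) ℚ.+ t) ([p-s]+s q s) (ℚ.+-monoʳ-< (q ℚ.- s) s<t)
  ; lower    = λ { p<q (a , b , a≺x , b≺y , q<a+b) →
      a , b , a≺x , b≺y , ℚ.<-trans p<q q<a+b }
  ; open′    = λ { (a , b , a≺x , b≺y , q<a+b) →
      let r , q<r , r<a+b = ℚ.<-dense q<a+b
      in r , q<r , a , b , a≺x , b≺y , r<a+b }
  }

-- If x = 0 there is no a ≥ 0 with a ≺ x, so 0 * ∞ = 0.
_*_ : ℝ≥0∞ → ℝ≥0∞ → ℝ≥0∞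
x * y = record
  { cut      = λ q → q ℚ.< 0ℚ ⊎
      (∃[ a ] ∃[ b ] 0ℚ ℚ.≤ a × a ≺ x × 0ℚ ℚ.≤ b × b ≺ y × q ℚ.< a ℚ.* b)
  ; negative = inj₁
  ; lower    = λ
      { p<q (inj₁ q<0) → inj₁ (ℚ.<-trans p<q q<0)
      ; p<q (inj₂ (a , b , 0≤a , a≺x , 0≤b , b≺y , q<ab)) →
          inj₂ (a , b , 0≤a , a≺x , 0≤b , b≺y , ℚ.<-trans p<q q<ab) }
  ; open′    = λ
      { (inj₁ q<0) → let r , q<r , r<0 = ℚ.<-dense q<0 in r , q<r , inj₁ r<0
      ; (inj₂ (a , b , 0≤a , a≺x , 0≤b , b≺y , q<ab)) →
          let r , q<r , r<ab = ℚ.<-dense q<ab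
          in r , q<r , inj₂ (a , b , 0≤a , a≺x , 0≤b , b≺y , r<ab) }
  }

-- ¬ (p ≺ y) says y ≤ p, so a rational q ≥ 0 lies below x - y when q + p lies
-- below x for some rational p ≥ y. In particular ∞ - ∞ = 0. For y ≤ x this is
-- the least z with x = y + z (see -‿isLeast); otherwise it is 0.
_-_ : ℝ≥0∞ → ℝ≥0∞ → ℝ≥0∞
x - y = record
  { cut      = λ q → q ℚ.< 0ℚ ⊎ (∃[ p ] ¬ (p ≺ y) × q ℚ.+ p ≺ x)
  ; negative = inj₁
  ; lower    = λ
      { p<q (inj₁ q<0) → inj₁ (ℚ.<-trans p<q q<0)
      ; p<q (inj₂ (s , s⊀y , q+s≺x)) →
          inj₂ (s , s⊀y , lower x (ℚ.+-monoˡ-< s p<q) q+s≺x) }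
  ; open′    = λ
      { (inj₁ q<0) → let r , q<r , r<0 = ℚ.<-dense q<0 in r , q<r , inj₁ r<0
      ; {q} (inj₂ (s , s⊀y , q+s≺x)) →
          let r , q+s<r , r≺x = open′ x q+s≺x
          in r ℚ.- s ,
             subst (ℚ._< r ℚ.- s) ([q+p]-p q s) (ℚ.+-monoˡ-< (ℚ.- s) q+s<r) ,
             inj₂ (s , s⊀y , subst (_≺ x) (sym ([p-s]+s r s)) r≺x) }
  }

private
  infixl 7 _×ℚ_

  _×ℚ_ : ℕ → ℚ → ℚ
  zero  ×ℚ e = 0ℚ
  suc n ×ℚ e = e ℚ.+ n ×ℚ e

  ×ℚ-* : ∀ n e → (n ×ℚ 1ℚ) ℚ.* e ≡ n ×ℚ e
  ×ℚ-* zero    e = ℚ.*-zeroˡ e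
  ×ℚ-* (suc n) e
    rewrite ℚ.*-distribʳ-+ e 1ℚ (n ×ℚ 1ℚ) | ℚ.*-identityˡ e | ×ℚ-* n e = refl

  toℚᵘ-×ℚ1 : ∀ n → ℚ.toℚᵘ (n ×ℚ 1ℚ) ℚᵘ.≃ ℚᵘ.mkℚᵘ (+ n) 0
  toℚᵘ-×ℚ1 zero    = ℚᵘ.≃-refl
  toℚᵘ-×ℚ1 (suc n) =
    ℚᵘ.≃-trans (ℚ.toℚᵘ-homo-+ 1ℚ (n ×ℚ 1ℚ))
      (ℚᵘ.≃-trans (ℚᵘ.+-congʳ ℚᵘ.1ℚᵘ (toℚᵘ-×ℚ1 n))
        (ℚᵘ.*≡* (cong (λ k → (+ 1 ℤ.+ k) ℤ.* + 1) (ℤ.*-identityʳ (+ n)))))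

  bound : ∀ q → ∃[ n ] q ℚ.< n ×ℚ 1ℚ
  bound q = n , ℚ.toℚᵘ-cancel-< (ℚᵘ.<-respʳ-≃ (ℚᵘ.≃-sym (toℚᵘ-×ℚ1 n)) (below q))
    where
    n = suc ℤ.∣ ℚ.↥ q ∣
    below : ∀ q → ℚ.toℚᵘ q ℚᵘ.< ℚᵘ.mkℚᵘ (+ suc ℤ.∣ ℚ.↥ q ∣) 0
    below (mkℚ (+ m) d _) = ℚᵘ.*<* (subst (ℤ._< + suc m ℤ.* + suc d)
      (sym (ℤ.*-identityʳ (+ m))) (ℤ.+<+ (ℕ.m≤m*n (suc m) (suc d))))
    below (mkℚ -[1+ m ] d _) = ℚᵘ.*<* ℤ.-<+

  archimedean : ∀ q {e} → 0ℚ ℚ.< e → ∃[ n ] q ℚ.< n ×ℚ e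
  archimedean q {e} 0<e =
    let n , q/e<n = bound (q ℚ.* ℚ.1/ e)
    in n , subst₂ ℚ._<_
             (begin-equality
               q ℚ.* ℚ.1/ e ℚ.* e    ≡⟨ ℚ.*-assoc q (ℚ.1/ e) e ⟩
               q ℚ.* (ℚ.1/ e ℚ.* e)  ≡⟨ cong (q ℚ.*_) (ℚ.*-inverseˡ e) ⟩
               q ℚ.* 1ℚ              ≡⟨ ℚ.*-identityʳ q ⟩
               q                     ∎)
             (×ℚ-* n e) (ℚ.*-monoˡ-<-pos e q/e<n)
    where
    open ℚ.≤-Reasoning
    instance
      e>0 = ℚ.positive 0<e
      e≢0 = ℚ.pos⇒nonZero e

  module Approximation (em : ExcludedMiddle 0ℓ) (y : ℝ≥0∞) where

    walk : ∀ n {a e} → a ≺ y → ¬ (a ℚ.+ n ×ℚ e ≺ y) →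
           ∃[ b ] b ≺ y × ¬ (b ℚ.+ e ≺ y)
    walk zero {a} a≺y a+0⊀y =
      contradiction (subst (_≺ y) (sym (ℚ.+-identityʳ a)) a≺y) a+0⊀y
    walk (suc n) {a} {e} a≺y a+ne⊀y with em {a ℚ.+ e ≺ y}
    ... | no  a+e⊀y = a , a≺y , a+e⊀y
    ... | yes a+e≺y = walk n a+e≺y
      (λ h → a+ne⊀y (subst (_≺ y) (ℚ.+-assoc a e (n ×ℚ e)) h))

    approximate : ∀ {p e} → ¬ (p ≺ y) → 0ℚ ℚ.< e → ∃[ b ] b ≺ y × ¬ (b ℚ.+ e ≺ y)
    approximate {p} {e} p⊀y 0<e =
      let n , p+1<ne = archimedean (p ℚ.+ 1ℚ) 0<e
          p<ne-1 = subst (ℚ._< ℚ.- 1ℚ ℚ.+ n ×ℚ e)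
                     ([p-s]+s-comm p) (ℚ.+-monoʳ-< (ℚ.- 1ℚ) p+1<ne)
      in walk n (negative y (ℚ.negative⁻¹ (ℚ.- 1ℚ))) (λ h → p⊀y (lower y p<ne-1 h))
      where
      open +-*-Solver
      [p-s]+s-comm : ∀ p → ℚ.- 1ℚ ℚ.+ (p ℚ.+ 1ℚ) ≡ p
      [p-s]+s-comm = solve 1 (λ p → con (ℚ.- 1ℚ) :+ (p :+ con 1ℚ) := p) refl

≺-⊀⇒< : ∀ y {a p} → a ≺ y → ¬ (p ≺ y) → a ℚ.< p
≺-⊀⇒< y {a} {p} a≺y p⊀y with ℚ.<-cmp a p
... | tri< a<p _ _  = a<p
... | tri≈ _ refl _ = contradiction a≺y p⊀y
... | tri> _ _ p<a  = contradiction (lower y p<a a≺y) p⊀y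

-‿isLeast : ExcludedMiddle 0ℓ → ∀ {x y} → y ≤ x →
            IsLeast _≤_ (λ z → x ≈ y + z) (x - y)
-‿isLeast em {x} {y} y≤x = (x≤y+[x-y] , y+[x-y]≤x) , least
  where
  x≤y+[x-y] : x ≤ y + (x - y)
  x≤y+[x-y] q q≺x with em {∃[ p ] ¬ (p ≺ y)}
  ... | no y=∞ =
    let b = ℚ.- 1ℚ
        b<0 = ℚ.negative⁻¹ b
        c , b<c , c<0 = ℚ.<-dense b<0
    in q ℚ.- b , c , decidable-stable em (λ h → y=∞ (q ℚ.- b , h)) , inj₁ c<0 ,
       subst (ℚ._< (q ℚ.- b) ℚ.+ c) ([p-s]+s q b) (ℚ.+-monoʳ-< (q ℚ.- b) b<c)
  ... | yes (p , p⊀y) =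
    let r , q<r , r≺x = open′ x q≺x
        s , q<s , s<r = ℚ.<-dense q<r
        a , a≺y , a+⊀y = Approximation.approximate em y p⊀y (<⇒0<- s<r)
    in a , s ℚ.- a , a≺y ,
       inj₂ (a ℚ.+ (r ℚ.- s) , a+⊀y , subst (_≺ x) (sym ([s-a]+[a+[r-s]] s a r)) r≺x) ,
       subst (q ℚ.<_) (sym (s+[p-s] a s)) q<s

  y+[x-y]≤x : y + (x - y) ≤ x
  y+[x-y]≤x q (a , b , a≺y , inj₁ b<0 , q<a+b) =
    lower x q<a+b (lower x a+b<a (y≤x a a≺y))
    where a+b<a = subst (a ℚ.+ b ℚ.<_) (ℚ.+-identityʳ a) (ℚ.+-monoʳ-< a b<0)
  y+[x-y]≤x q (a , b , a≺y , inj₂ (p , p⊀y , b+p≺x) , q<a+b) =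
    lower x q<a+b (lower x a+b<b+p b+p≺x)
    where a+b<b+p = subst (ℚ._< b ℚ.+ p) (ℚ.+-comm b a)
                      (ℚ.+-monoʳ-< b (≺-⊀⇒< y a≺y p⊀y))

  least : ∀ z → x ≈ y + z → x - y ≤ z
  least z _ q (inj₁ q<0) = negative z q<0
  least z (x≤y+z , _) q (inj₂ (p , p⊀y , q+p≺x)) with x≤y+z (q ℚ.+ p) q+p≺x
  ... | a , b , a≺y , b≺z , q+p<a+b = lower z q<b b≺z
    where
    q+p<b+p : q ℚ.+ p ℚ.< b ℚ.+ p
    q+p<b+p = ℚ.<-trans (subst (q ℚ.+ p ℚ.<_) (ℚ.+-comm a b) q+p<a+b)
                (ℚ.+-monoʳ-< b (≺-⊀⇒< y a≺y p⊀y))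
    q<b : q ℚ.< b
    q<b = subst₂ ℚ._<_ ([q+p]-p q p) ([q+p]-p b p) (ℚ.+-monoˡ-< (ℚ.- p) q+p<b+p)

IsFinite : ℝ≥0∞ → Set
IsFinite x = ∃[ q ] ¬ (q ≺ x)

ℝ≥0 : Set₁
ℝ≥0 = Σ ℝ≥0∞ IsFinite

𝔼 : Set ℓ → Set (ℓ ⊔ lsuc 0ℓ)
𝔼 D = D → ℝ≥0∞

module _ {D : Set ℓ} where

  infix 4 _⊑_ _≋_
  infixl 6 _⊕_ _⊖_
  infixl 7 _⊙_

  _⊑_ _≋_ : Rel (𝔼 D) ℓ
  η ⊑ θ = ∀ d → η d ≤ θ d
  η ≋ θ = ∀ d → η d ≈ θ d

  𝕆 : 𝔼 D
  𝕆 _ = 0∞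

  _⊕_ _⊖_ : 𝔼 D → 𝔼 D → 𝔼 D
  (η ⊕ θ) d = η d + θ d
  (η ⊖ θ) d = η d - θ d

  _⊙_ : ℝ≥0∞ → 𝔼 D → 𝔼 D
  (α ⊙ η) d = α * η d

  ⌊_⌋ : (D → ℝ≥0) → 𝔼 D
  ⌊ u ⌋ d = proj₁ (u d)

  Affine : (𝔼 D → 𝔼 D) → Set (ℓ ⊔ lsuc 0ℓ)
  Affine K = ∀ α → α ≤ 1∞ → ∀ η₁ η₂ →
    K (α ⊙ η₁ ⊕ (1∞ - α) ⊙ η₂) ≋ α ⊙ K η₁ ⊕ (1∞ - α) ⊙ K η₂

  -- For affine K one has K 𝕆 ⊑ K η: apply affinity to η = (1/n)(n η) + (1 - 1/n) 𝕆
  -- and let n grow. So the subtraction is a genuine one.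
  𝖣 : (𝔼 D → 𝔼 D) → 𝔼 D → 𝔼 D
  𝖣 K η = K η ⊖ K 𝕆

  IsRankingSupermartingale : (D → ℝ≥0) → (𝔼 D → 𝔼 D) → (D → ℝ≥0) → Set ℓ
  IsRankingSupermartingale u L r = L ⌊ r ⌋ ⊕ ⌊ u ⌋ ⊑ ⌊ r ⌋

-- Distinct cuts may describe the same number, so a function 𝔼 D → 𝔼 D in the
-- set-theoretic sense is a map of this setoid.
𝔼-setoid : Set ℓ → Setoid (ℓ ⊔ lsuc 0ℓ) ℓ
𝔼-setoid D = record
  { Carrier       = 𝔼 D
  ; _≈_           = _≋_
  ; isEquivalence = record
    { refl  = λ d → (λ q h → h) , (λ q h → h)
    ; sym   = λ e d → proj₂ (e d) , proj₁ (e d)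
    ; trans = λ e f d → (λ q h → proj₁ (f d) q (proj₁ (e d) q h))
                      , (λ q h → proj₂ (e d) q (proj₂ (f d) q h))
    }
  }

{-# OPTIONS --safe #-}

-- Affinity with weight ½ gives K η + K θ = K (η + θ) + K 𝕆, so L = 𝖣 K is
-- superadditive and monotone. Applying L repeatedly to L r + u ≤ r yields
-- Lⁿ⁺¹ r + Lⁿ u ≤ Lⁿ r. If Lⁿ u d ≥ l > 0 for all n, then Lⁿ r d drops by at
-- least l at each step, which is impossible when it starts at r d < ∞.

module Submission where

open import Defs
open import Level using (Level; 0ℓ)
open import Axiom.ExcludedMiddle using (ExcludedMiddle)
open import Algebra.Bundles using (CommutativeRing)
open import Data.Integer as ℤ using (+_; -[1+_])
import Data.Integer.Properties as ℤ
open import Data.Nat using (ℕ; zero; suc)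
import Data.Nat.Properties as ℕ
open import Data.Nat.GeneralisedArithmetic using (fold)
open import Data.Product using (∃; ∃-syntax; _×_; _,_; proj₁; proj₂)
open import Data.Rational as ℚ using (ℚ; 0ℚ; 1ℚ; ½; mkℚ)
import Data.Rational.Properties as ℚ
open import Data.Rational.Solver using (module +-*-Solver)
import Data.Rational.Unnormalised as ℚᵘ
import Data.Rational.Unnormalised.Properties as ℚᵘ
open import Data.Sum using (inj₁; inj₂)
open import Function.Bundles using (Func; _⟶ₛ_)
open import Relation.Binary.PropositionalEquality
  using (_≡_; refl; sym; cong; subst; subst₂)
open import Relation.Nullary using (¬_; yes; no; contradiction)
open import Relation.Nullary.Decidable using (decidable-stable)

open import Algebra.Properties.Semiring.Mult
  (CommutativeRing.semiring ℚ.+-*-commutativeRing) using (×-assoc-*) renaming (_×_ to _×ℚ_)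

private
  variable
    ℓ : Level

-- The Archimedean property of the rationals.

toℚᵘ-×1 : ∀ n → ℚ.toℚᵘ (n ×ℚ 1ℚ) ℚᵘ.≃ ℚᵘ.mkℚᵘ (+ n) 0
toℚᵘ-×1 zero    = ℚᵘ.≃-refl
toℚᵘ-×1 (suc n) = begin
  ℚ.toℚᵘ (1ℚ ℚ.+ n ×ℚ 1ℚ)            ≈⟨ ℚ.toℚᵘ-homo-+ 1ℚ (n ×ℚ 1ℚ) ⟩
  ℚᵘ.1ℚᵘ ℚᵘ.+ ℚ.toℚᵘ (n ×ℚ 1ℚ)       ≈⟨ ℚᵘ.+-congʳ ℚᵘ.1ℚᵘ (toℚᵘ-×1 n) ⟩
  ℚᵘ.1ℚᵘ ℚᵘ.+ ℚᵘ.mkℚᵘ (+ n) 0        ≈⟨ ℚᵘ.*≡* (cong (λ k → (+ 1 ℤ.+ k) ℤ.* + 1) (ℤ.*-identityʳ (+ n))) ⟩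
  ℚᵘ.mkℚᵘ (+ suc n) 0                ∎
  where open import Relation.Binary.Reasoning.Setoid ℚᵘ.≃-setoid

<-×1 : ∀ q → ∃[ n ] q ℚ.< n ×ℚ 1ℚ
<-×1 q = n , ℚ.toℚᵘ-cancel-< (ℚᵘ.<-respʳ-≃ (ℚᵘ.≃-sym (toℚᵘ-×1 n)) (below q))
  where
  -- Denominators are at least 1, so the absolute value of the numerator plus 1 exceeds `q`.
  n = suc ℤ.∣ ℚ.↥ q ∣
  below : ∀ q → ℚ.toℚᵘ q ℚᵘ.< ℚᵘ.mkℚᵘ (+ suc ℤ.∣ ℚ.↥ q ∣) 0
  below (mkℚ (+ m) d _)    = ℚᵘ.*<* (subst (ℤ._< + suc m ℤ.* + suc d)
    (sym (ℤ.*-identityʳ (+ m))) (ℤ.+<+ (ℕ.m≤m*n (suc m) (suc d))))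
  below (mkℚ -[1+ _ ] _ _) = ℚᵘ.*<* ℤ.-<+

archimedean : ∀ q {e} → 0ℚ ℚ.< e → ∃[ n ] q ℚ.< n ×ℚ e
archimedean q {e} 0<e =
  let n , q/e<n = <-×1 (q ℚ.÷ e)
  in n , (begin-strict
    q                      ≡⟨ ℚ.*-identityʳ q ⟨
    q ℚ.* 1ℚ               ≡⟨ cong (q ℚ.*_) (ℚ.*-inverseˡ e) ⟨
    q ℚ.* (ℚ.1/ e ℚ.* e)   ≡⟨ ℚ.*-assoc q (ℚ.1/ e) e ⟨
    q ℚ.÷ e ℚ.* e          <⟨ ℚ.*-monoˡ-<-pos e q/e<n ⟩
    (n ×ℚ 1ℚ) ℚ.* e        ≡⟨ ×-assoc-* n 1ℚ e ⟩
    n ×ℚ (1ℚ ℚ.* e)        ≡⟨ cong (n ×ℚ_) (ℚ.*-identityˡ e) ⟩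
    n ×ℚ e                 ∎)
  where
  open ℚ.≤-Reasoning
  instance
    e>0 = ℚ.positive 0<e
    e≢0 = ℚ.pos⇒nonZero e

-- Identities and inequalities between rationals.

module _ where
  open +-*-Solver

  ½p+½p≡p : ∀ p → ½ ℚ.* p ℚ.+ ½ ℚ.* p ≡ p
  ½p+½p≡p = solve 1 (λ p → con ½ :* p :+ con ½ :* p := p) refl

  ½[p+p]≡p : ∀ p → ½ ℚ.* (p ℚ.+ p) ≡ p
  ½[p+p]≡p = solve 1 (λ p → con ½ :* (p :+ p) := p) refl

  [p+q]+[r+s]≡[p+r]+[q+s] : ∀ p q r s → (p ℚ.+ q) ℚ.+ (r ℚ.+ s) ≡ (p ℚ.+ r) ℚ.+ (q ℚ.+ s)
  [p+q]+[r+s]≡[p+r]+[q+s] = solve 4 (λ p q r s → (p :+ q) :+ (r :+ s) := (p :+ r) :+ (q :+ s)) refl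

  [p+q]-q≡p : ∀ p q → (p ℚ.+ q) ℚ.- q ≡ p
  [p+q]-q≡p = solve 2 (λ p q → (p :+ q) :- q := p) refl

  [p-q]+q≡p : ∀ p q → (p ℚ.- q) ℚ.+ q ≡ p
  [p-q]+q≡p = solve 2 (λ p q → (p :- q) :+ q := p) refl

  p+[q-p]≡q : ∀ p q → p ℚ.+ (q ℚ.- p) ≡ q
  p+[q-p]≡q = solve 2 (λ p q → p :+ (q :- p) := q) refl

  -1+[p+1]≡p : ∀ p → ℚ.- 1ℚ ℚ.+ (p ℚ.+ 1ℚ) ≡ p
  -1+[p+1]≡p = solve 1 (λ p → con (ℚ.- 1ℚ) :+ (p :+ con 1ℚ) := p) refl

+-cancelʳ-< : ∀ r {p q} → p ℚ.+ r ℚ.< q ℚ.+ r → p ℚ.< q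
+-cancelʳ-< r {p} {q} h =
  subst₂ ℚ._<_ ([p+q]-q≡p p r) ([p+q]-q≡p q r) (ℚ.+-monoˡ-< (ℚ.- r) h)

p<q⇒0<q-p : ∀ {p q} → p ℚ.< q → 0ℚ ℚ.< q ℚ.- p
p<q⇒0<q-p {p} {q} p<q = subst (ℚ._< q ℚ.- p) (ℚ.+-inverseʳ p) (ℚ.+-monoˡ-< (ℚ.- p) p<q)

p+p<q⇒p<½q : ∀ {p q} → p ℚ.+ p ℚ.< q → p ℚ.< ½ ℚ.* q
p+p<q⇒p<½q {p} {q} h = subst (ℚ._< ½ ℚ.* q) (½[p+p]≡p p) (ℚ.*-monoʳ-<-pos ½ h)

-- Order and addition of cuts.

≤-refl : ∀ x → x ≤ x
≤-refl _ _ h = h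

-- The cut of a sum asks for a strict inequality; openness of both cuts supplies the room.
≺-+ : ∀ x y {a b} → a ≺ x → b ≺ y → a ℚ.+ b ≺ (x + y)
≺-+ x y a≺x b≺y =
  let a′ , a<a′ , a′≺x = open′ x a≺x
      b′ , b<b′ , b′≺y = open′ y b≺y
  in a′ , b′ , a′≺x , b′≺y , ℚ.+-mono-< a<a′ b<b′

x≤x+y : ∀ x y → x ≤ x + y
x≤x+y x y q q≺x =
  -- Moving up to `r` makes the remainder `q - r` negative, and negative rationals lie in every cut.
  let r , q<r , r≺x = open′ x q≺x
      q-r<0 = subst (q ℚ.- r ℚ.<_) (ℚ.+-inverseʳ r) (ℚ.+-monoˡ-< (ℚ.- r) q<r)
  in subst (_≺ (x + y)) (p+[q-p]≡q r q) (≺-+ x y r≺x (negative y q-r<0))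

x+0≤x : ∀ x → x + 0∞ ≤ x
x+0≤x x q (a , b , a≺x , b<0 , q<a+b) =
  lower x (ℚ.<-trans q<a+b (subst (a ℚ.+ b ℚ.<_) (ℚ.+-identityʳ a) (ℚ.+-monoʳ-< a b<0))) a≺x

-- Since `q` bounds `w` from above, `p + r` below `w + x` leaves `p + (r - q)` below `x`. For
-- `q < r` this is a constant positive gain, the form that `descent` consumes.
≺-exchange : ∀ w x y z {p q r} → y + z ≤ w + x → r ≺ z → ¬ (q ≺ w) →
             p ≺ y → p ℚ.+ (r ℚ.- q) ≺ x
≺-exchange w x y z {p} {q} {r} y+z≤w+x r≺z q⊀w p≺y =
  let s , t , s≺w , t≺x , p+r<s+t = y+z≤w+x (p ℚ.+ r) (≺-+ y z p≺y r≺z)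
  in lower x (+-cancelʳ-< q (begin-strict
       p ℚ.+ (r ℚ.- q) ℚ.+ q    ≡⟨ ℚ.+-assoc p (r ℚ.- q) q ⟩
       p ℚ.+ ((r ℚ.- q) ℚ.+ q)  ≡⟨ cong (p ℚ.+_) ([p-q]+q≡p r q) ⟩
       p ℚ.+ r                  <⟨ p+r<s+t ⟩
       s ℚ.+ t                  ≡⟨ ℚ.+-comm s t ⟩
       t ℚ.+ s                  <⟨ ℚ.+-monoʳ-< t (≺-⊀⇒< w s≺w q⊀w) ⟩
       t ℚ.+ q                  ∎)) t≺x
  where open ℚ.≤-Reasoning

-- The weight one half and averages.

½∞ : ℝ≥0∞
½∞ = record
  { cut      = ℚ._< ½
  ; negative = λ q<0 → ℚ.<-trans q<0 (ℚ.positive⁻¹ ½)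
  ; lower    = ℚ.<-trans
  ; open′    = ℚ.<-dense
  }

½∞≤1∞ : ½∞ ≤ 1∞
½∞≤1∞ q q<½ = ℚ.<-trans q<½ (ℚ.*<* (ℤ.+<+ ℕ.≤-refl))

1∞-½∞≈½∞ : 1∞ - ½∞ ≈ ½∞
1∞-½∞≈½∞ = to , from
  where
  to : 1∞ - ½∞ ≤ ½∞
  to q (inj₁ q<0)             = negative ½∞ q<0
  to q (inj₂ (p , p≮½ , q+p<1)) =
    -- `½ ℚ.+ ½` computes to `1ℚ`, so cancelling `½` turns the bound 1 into `½`.
    +-cancelʳ-< ½ (ℚ.≤-<-trans (ℚ.+-monoʳ-≤ q (ℚ.≮⇒≥ p≮½)) q+p<1)
  from : ½∞ ≤ 1∞ - ½∞
  from q q<½ = inj₂ (½ , ℚ.<-irrefl refl , ℚ.+-monoˡ-< ½ q<½)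

-- Halving is expressed by doubling the tested rational. The weight is fixed only up to `≈`, which
-- covers both `½∞` and `1∞ - ½∞`.
module _ {α : ℝ≥0∞} (α≈½ : α ≈ ½∞) (x : ℝ≥0∞) where

  ≺-½*⇒ : ∀ {q} → q ≺ (α * x) → q ℚ.+ q ≺ x
  ≺-½*⇒ (inj₁ q<0) = negative x (ℚ.+-mono-< q<0 q<0)
  ≺-½*⇒ {q} (inj₂ (a , b , _ , a≺α , 0≤b , b≺x , q<ab)) = lower x (begin-strict
    q ℚ.+ q              <⟨ ℚ.+-mono-< q<ab q<ab ⟩
    a ℚ.* b ℚ.+ a ℚ.* b  ≤⟨ ℚ.+-mono-≤ ab≤½b ab≤½b ⟩
    ½ ℚ.* b ℚ.+ ½ ℚ.* b  ≡⟨ ½p+½p≡p b ⟩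
    b                    ∎) b≺x
    where
    open ℚ.≤-Reasoning
    ab≤½b = ℚ.*-monoʳ-≤-nonNeg b {{ℚ.nonNegative 0≤b}} (ℚ.<⇒≤ (proj₁ α≈½ a a≺α))

  ≺-½*⇐ : ∀ {q} → q ℚ.+ q ≺ x → q ≺ (α * x)
  ≺-½*⇐ {q} q+q≺x with q ℚ.<? 0ℚ
  ... | yes q<0 = inj₁ q<0
  ... | no  q≮0 = inj₂ (a , b , ℚ.<⇒≤ 0<a , proj₂ α≈½ a a<½ , ℚ.<⇒≤ 0<b , proj₂ (proj₂ above) ,
                        subst (q ℚ.<_) (sym ab≡s) q<s)
    where
    0≤q = ℚ.≮⇒≥ q≮0
    -- Openness gives `b` with `q + q < b`, hence `b > 0` and `q < ½ b`. Any `s` strictly between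
    -- `q` and `½ b` factors as `a b` with `a = s / b` below `½`.
    above = open′ x q+q≺x
    b = proj₁ above
    0<b = ℚ.≤-<-trans (ℚ.+-mono-≤ 0≤q 0≤q) (proj₁ (proj₂ above))
    instance
      b>0 = ℚ.positive 0<b
      b≥0 = ℚ.pos⇒nonNeg b
      b≢0 = ℚ.pos⇒nonZero b
    between = ℚ.<-dense (p+p<q⇒p<½q (proj₁ (proj₂ above)))
    s = proj₁ between
    q<s = proj₁ (proj₂ between)
    a = s ℚ.÷ b
    open ℚ.≤-Reasoning
    ab≡s : a ℚ.* b ≡ s
    ab≡s = begin-equality
      s ℚ.* ℚ.1/ b ℚ.* b    ≡⟨ ℚ.*-assoc s (ℚ.1/ b) b ⟩
      s ℚ.* (ℚ.1/ b ℚ.* b)  ≡⟨ cong (s ℚ.*_) (ℚ.*-inverseˡ b) ⟩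
      s ℚ.* 1ℚ              ≡⟨ ℚ.*-identityʳ s ⟩
      s                     ∎
    0<a : 0ℚ ℚ.< a
    0<a = ℚ.*-cancelʳ-<-nonNeg b
      (subst₂ ℚ._<_ (sym (ℚ.*-zeroˡ b)) (sym ab≡s) (ℚ.≤-<-trans 0≤q q<s))
    a<½ : a ℚ.< ½
    a<½ = ℚ.*-cancelʳ-<-nonNeg b (subst (ℚ._< ½ ℚ.* b) (sym ab≡s) (proj₂ (proj₂ between)))

module _ {α β : ℝ≥0∞} (α≈½ : α ≈ ½∞) (β≈½ : β ≈ ½∞) where

  ≺-average⇒ : ∀ x y {q} → q ≺ (α * x + β * y) → q ℚ.+ q ≺ (x + y)
  ≺-average⇒ x y {q} (a , b , a≺ , b≺ , q<a+b) =
    a ℚ.+ a , b ℚ.+ b , ≺-½*⇒ {α} α≈½ x a≺ , ≺-½*⇒ {β} β≈½ y b≺ ,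
    subst (q ℚ.+ q ℚ.<_) ([p+q]+[r+s]≡[p+r]+[q+s] a b a b) (ℚ.+-mono-< q<a+b q<a+b)

  ≺-average⇐ : ∀ x y {q} → q ℚ.+ q ≺ (x + y) → q ≺ (α * x + β * y)
  ≺-average⇐ x y {q} (a , b , a≺x , b≺y , q+q<a+b) =
    ½ ℚ.* a , ½ ℚ.* b ,
    ≺-½*⇐ {α} α≈½ x (subst (_≺ x) (sym (½p+½p≡p a)) a≺x) ,
    ≺-½*⇐ {β} β≈½ y (subst (_≺ y) (sym (½p+½p≡p b)) b≺y) ,
    subst (q ℚ.<_) (ℚ.*-distribˡ-+ ½ a b) (p+p<q⇒p<½q q+q<a+b)

  average-mono-≤ : ∀ x y x′ y′ → x + y ≤ x′ + y′ → α * x + β * y ≤ α * x′ + β * y′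
  average-mono-≤ x y x′ y′ h q q≺ = ≺-average⇐ x′ y′ (h (q ℚ.+ q) (≺-average⇒ x y q≺))

  -- Halving loses no information, even at infinity: `q` in the sum corresponds to `½ q` in the
  -- average.
  average-cancel-≤ : ∀ x y x′ y′ → α * x + β * y ≤ α * x′ + β * y′ → x + y ≤ x′ + y′
  average-cancel-≤ x y x′ y′ h q q≺ = subst (_≺ (x′ + y′)) (½p+½p≡p q)
    (≺-average⇒ x′ y′ (h (½ ℚ.* q) (≺-average⇐ x y
      (subst (_≺ (x + y)) (sym (½p+½p≡p q)) q≺))))

-- Descent in constant steps.

-- The negative rational -1 lies in every `x n`, and climbing back to `x 0` raises it by `n` times
-- `e`. As `n` is arbitrary, `x 0` is infinite.
descent : ∀ (x : ℕ → ℝ≥0∞) {e} → 0ℚ ℚ.< e →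
          (∀ n {a} → a ≺ x (suc n) → a ℚ.+ e ≺ x n) → ∀ p → p ≺ x 0
descent x {e} 0<e step p =
  -- The extra 1 compensates for the start at -1.
  let n , p+1<ne = archimedean (p ℚ.+ 1ℚ) 0<e
      p<ne-1 = subst (ℚ._< ℚ.- 1ℚ ℚ.+ n ×ℚ e) (-1+[p+1]≡p p) (ℚ.+-monoʳ-< (ℚ.- 1ℚ) p+1<ne)
  in lower (x 0) p<ne-1 (steps n (negative (x n) (ℚ.negative⁻¹ (ℚ.- 1ℚ))))
  where
  steps : ∀ n {a} → a ≺ x n → a ℚ.+ n ×ℚ e ≺ x 0
  steps zero    {a} a≺x = subst (_≺ x 0) (sym (ℚ.+-identityʳ a)) a≺x
  steps (suc n) {a} a≺x = subst (_≺ x 0) (ℚ.+-assoc a e (n ×ℚ e)) (steps n (step n a≺x))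

-- Subtraction of cuts.

module _ (em : ExcludedMiddle 0ℓ) where

  -- Otherwise adding `e` never leaves the cut, so `descent` along the constant sequence makes `x`
  -- infinite.
  approximate : ∀ x {e} → IsFinite x → 0ℚ ℚ.< e → ∃[ a ] a ≺ x × ¬ (a ℚ.+ e ≺ x)
  approximate x (p , p⊀x) 0<e = decidable-stable em λ none →
    p⊀x (descent (λ _ → x) 0<e
      (λ _ a≺x → decidable-stable em (λ a+e⊀x → none (_ , a≺x , a+e⊀x))) p)

  -- Negative rationals belong to a difference by default. When `y` is finite and at most `x`, they
  -- have a genuine witness too: approximate `y` by `a` to within `- q` and take `p = a - q`, so
  -- that `q + p = a`.
  ≺-minus⇒ : ∀ x y {q} → IsFinite y → y ≤ x → q ≺ (x - y) → ∃[ p ] ¬ (p ≺ y) × q ℚ.+ p ≺ x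
  ≺-minus⇒ _ _ _ _ (inj₂ h) = h
  ≺-minus⇒ x y {q} fin y≤x (inj₁ q<0) =
    let a , a≺y , a-q⊀y = approximate y fin (ℚ.neg-antimono-< q<0)
    in a ℚ.- q , a-q⊀y , subst (_≺ x) (sym (p+[q-p]≡q q a)) (y≤x a a≺y)

  -- For c = ∞ all three differences are 0, whatever x, y and z are.
  minus-superadditive : ∀ x y z c → (IsFinite c → c ≤ x) → (IsFinite c → c ≤ y) →
                        x + y ≤ z + c → (x - c) + (y - c) ≤ z - c
  minus-superadditive x y z c c≤x c≤y x+y≤z+c q (a , b , a≺ , b≺ , q<a+b)
    with em {IsFinite c}
  ... | no c=∞ = inj₁ (ℚ.<-trans q<a+b (ℚ.+-mono-< (minus-∞ {x} a≺) (minus-∞ {y} b≺)))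
    where
    minus-∞ : ∀ {x a} → a ≺ (x - c) → a ℚ.< 0ℚ
    minus-∞ (inj₁ a<0)           = a<0
    minus-∞ (inj₂ (p , p⊀c , _)) = contradiction (p , p⊀c) c=∞
  ... | yes fin =
    let p , p⊀c , a+p≺x = ≺-minus⇒ x c fin (c≤x fin) a≺
        s , s⊀c , b+s≺y = ≺-minus⇒ y c fin (c≤y fin) b≺
        f , g , f≺z , g≺c , <f+g = x+y≤z+c _ (≺-+ x y a+p≺x b+s≺y)
        open ℚ.≤-Reasoning
        q+p<f = +-cancelʳ-< s (begin-strict
          q ℚ.+ p ℚ.+ s            ≡⟨ ℚ.+-assoc q p s ⟩
          q ℚ.+ (p ℚ.+ s)          <⟨ ℚ.+-monoˡ-< (p ℚ.+ s) q<a+b ⟩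
          a ℚ.+ b ℚ.+ (p ℚ.+ s)    ≡⟨ [p+q]+[r+s]≡[p+r]+[q+s] a b p s ⟩
          a ℚ.+ p ℚ.+ (b ℚ.+ s)    <⟨ <f+g ⟩
          f ℚ.+ g                  <⟨ ℚ.+-monoʳ-< f (≺-⊀⇒< c g≺c s⊀c) ⟩
          f ℚ.+ s                  ∎)
    in inj₂ (p , p⊀c , lower z q+p<f f≺z)

-- Affine maps and the operator `𝖣`.

module _ (em : ExcludedMiddle 0ℓ) {D : Set ℓ} (K : 𝔼-setoid D ⟶ₛ 𝔼-setoid D)
         (affine : Affine (Func.to K)) where

  open Func K using (to) renaming (cong to K-cong)

  -- The average of `η` and `θ` is also the average of `η ⊕ θ` and `𝕆`. Affinity evaluates `K` there
  -- in two ways, and the factor one half cancels. Keeping `K 𝕆` as a summand leaves the identity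
  -- valid where it is infinite.
  K-+ : ∀ η θ d → to η d + to θ d ≈ to (η ⊕ θ) d + to 𝕆 d
  K-+ η θ d =
    average-cancel-≤ {½∞} {1∞ - ½∞} ≈-refl 1∞-½∞≈½∞ (to η d) (to θ d) (to (η ⊕ θ) d) (to 𝕆 d)
      (λ q h → proj₁ (K-½ (η ⊕ θ) 𝕆) q (proj₁ same q (proj₂ (K-½ η θ) q h))) ,
    average-cancel-≤ {½∞} {1∞ - ½∞} ≈-refl 1∞-½∞≈½∞ (to (η ⊕ θ) d) (to 𝕆 d) (to η d) (to θ d)
      (λ q h → proj₁ (K-½ η θ) q (proj₂ same q (proj₂ (K-½ (η ⊕ θ) 𝕆) q h)))
    where
    ≈-refl : ½∞ ≈ ½∞
    ≈-refl = ≤-refl ½∞ , ≤-refl ½∞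
    average : 𝔼 D → 𝔼 D → 𝔼 D
    average η θ = ½∞ ⊙ η ⊕ (1∞ - ½∞) ⊙ θ
    K-½ : ∀ η θ → to (average η θ) d ≈ average (to η) (to θ) d
    K-½ η θ = affine ½∞ ½∞≤1∞ η θ d
    same : to (average η θ) d ≈ to (average (η ⊕ θ) 𝕆) d
    same = K-cong {average η θ} {average (η ⊕ θ) 𝕆} (λ d →
      average-mono-≤ {½∞} {1∞ - ½∞} ≈-refl 1∞-½∞≈½∞ (η d) (θ d) (η d + θ d) 0∞ (x≤x+y (η d + θ d) 0∞) ,
      average-mono-≤ {½∞} {1∞ - ½∞} ≈-refl 1∞-½∞≈½∞ (η d + θ d) 0∞ (η d) (θ d) (x+0≤x (η d + θ d))) d

  -- With xₙ = K (n η), K-+ reads x₁ + xₙ = xₙ₊₁ + x₀: if x₁ < x₀, then xₙ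
  -- decreases in constant steps.
  K𝕆≤K : ∀ η d → IsFinite (to 𝕆 d) → to 𝕆 d ≤ to η d
  K𝕆≤K η d (p , p⊀K𝕆) q q≺K𝕆 = decidable-stable em ¬q⊀Kη
    where
    x : ℕ → ℝ≥0∞
    x n = to (fold 𝕆 (η ⊕_) n) d
    ¬q⊀Kη : ¬ ¬ (q ≺ to η d)
    ¬q⊀Kη q⊀Kη = p⊀K𝕆 (descent x (p<q⇒0<q-p q<s) step p)
      where
      above = open′ (to 𝕆 d) q≺K𝕆
      s = proj₁ above
      q<s = proj₁ (proj₂ above)
      step : ∀ n {a} → a ≺ x (suc n) → a ℚ.+ (s ℚ.- q) ≺ x n
      step n = ≺-exchange (to η d) (x n) (x (suc n)) (x 0) (proj₂ (K-+ η (fold 𝕆 (η ⊕_) n) d))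
        (proj₂ (proj₂ above)) q⊀Kη

  -- Subtract `K 𝕆` from both summands in `K-+`. A separate `ζ` admits sums known only up to `≋`,
  -- transported by `K-cong`.
  𝖣-⊕ : ∀ η θ ζ → η ⊕ θ ≋ ζ → 𝖣 to η ⊕ 𝖣 to θ ⊑ 𝖣 to ζ
  𝖣-⊕ η θ ζ η⊕θ≋ζ d =
    minus-superadditive em (to η d) (to θ d) (to ζ d) (to 𝕆 d) (K𝕆≤K η d) (K𝕆≤K θ d)
      λ q h → let a , b , a≺ , b≺ , q<a+b = proj₁ (K-+ η θ d) q h
              in a , b , proj₁ (K-cong {η ⊕ θ} {ζ} η⊕θ≋ζ d) a a≺ , b≺ , q<a+b

  𝖣-superadditive : ∀ η θ ζ → η ⊕ θ ⊑ ζ → 𝖣 to η ⊕ 𝖣 to θ ⊑ 𝖣 to ζ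
  𝖣-superadditive η θ ζ η⊕θ⊑ζ d q h =
    𝖣-⊕ (η ⊕ θ) ω ζ (λ d → let ζ≤ , ≤ζ = proj₁ (-‿isLeast em {ζ d} {η d + θ d} (η⊕θ⊑ζ d)) in ≤ζ , ζ≤) d q
      (x≤x+y (𝖣 to (η ⊕ θ) d) (𝖣 to ω d) q
        (𝖣-⊕ η θ (η ⊕ θ) (λ d → ≤-refl (η d + θ d) , ≤-refl (η d + θ d)) d q h))
    where
    ω = ζ ⊖ (η ⊕ θ)

  𝖣-iterate : ∀ u r → IsRankingSupermartingale u (𝖣 to) r → ∀ n →
              fold ⌊ r ⌋ (𝖣 to) (suc n) ⊕ fold ⌊ u ⌋ (𝖣 to) n ⊑ fold ⌊ r ⌋ (𝖣 to) n
  𝖣-iterate u r ranking zero    = ranking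
  𝖣-iterate u r ranking (suc n) =
    𝖣-superadditive (fold ⌊ r ⌋ (𝖣 to) (suc n)) (fold ⌊ u ⌋ (𝖣 to) n) (fold ⌊ r ⌋ (𝖣 to) n)
      (𝖣-iterate u r ranking n)

theorem3p6 : ∀ {ℓ} → ExcludedMiddle 0ℓ →
    (D : Set ℓ) (K : 𝔼-setoid D ⟶ₛ 𝔼-setoid D) → Affine (Func.to K) →
    (u : D → ℝ≥0) →
    ∃ (λ r → IsRankingSupermartingale u (𝖣 (Func.to K)) r) →
    IsInfimum _⊑_ (λ n → fold ⌊ u ⌋ (𝖣 (Func.to K)) n) 𝕆
theorem3p6 em D K affine u (r , ranking) =
  (λ n d q → negative (uₙ n d)) , greatest
  where
  uₙ rₙ : ℕ → 𝔼 D
  uₙ = fold ⌊ u ⌋ (𝖣 (Func.to K))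
  rₙ = fold ⌊ r ⌋ (𝖣 (Func.to K))
  greatest : ∀ l → (∀ n → l ⊑ uₙ n) → l ⊑ 𝕆
  greatest l l⊑uₙ d q q≺l with q ℚ.<? 0ℚ
  ... | yes q<0 = q<0
  ... | no  q≮0 =
    -- Here `q` may be 0, so openness is used to obtain a strictly positive step `e` below `l d`.
    let e , q<e , e≺l = open′ (l d) q≺l
        p , p⊀r = proj₂ (r d)
        step = λ n {a} a≺rₙ → 𝖣-iterate em K affine u r ranking n d (a ℚ.+ e)
          (≺-+ (rₙ (suc n) d) (uₙ n d) a≺rₙ (l⊑uₙ n d e e≺l))
    -- `p` is an upper bound of `r d`, the start of the sequence, while `descent` puts every
    -- rational below it.
    in contradiction (descent (λ n → rₙ n d) (ℚ.≤-<-trans (ℚ.≮⇒≥ q≮0) q<e) step p) p⊀r
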